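{- Consider integers $n,\tau\in\mathbb Z_{+}$ such that $n\ge3\tau$, as well as a pair of functions $\mathsf E:\{0,1\}^n\to\{0,1\}^*$ and $\mathsf D:\{0,1\}^*\to2^{[0..n)}$ jointly satisfying the following property: for every $T\in\{0,1\}^n$, the set $\mathsf D(\mathsf E(T))$ is a $\tau$-synchronizing set of $T$. Then, there exists $T\in\{0,1\}^n$ such that $|\mathsf E(T)|=\Omega\left(\frac n\tau\lg\tau\right)$.
   Context: Notation: $\mathbb Z_+$ is the set of positive integers; $[i..j]=\{h\in\mathbb Z: i\le h\le j\}$, $[i..j)=[i..j-1]$; $2^{X}$ is the power set of $X$; $\{0,1\}^*$ is the set of all finite bit strings; $|B|$ is the length of a bit string $B$; $\lg x=\log_2\max(1,x)$. Strings are indexed from $0$; $T[i..j)$ denotes $T[i]T[i+1]\cdots T[j-1]$. Periods: an integer $p\in[1..|S|]$ is a period of a string $S$ if $S[i]=S[i+p]$ for all $i\in[0..|S|-p)$; $\mathrm{per}(S)$ is the smallest period of a non-empty string $S$. Synchronizing set: for a string $T[0..n)$ and $\tau\in[1..\lfloor n/2\rfloor]$, a set $\mathsf{Sync}\subseteq[0..n-2\tau]$ is a $\tau$-synchronizing set of $T$ if it satisfies the following two conditions: (Consistency) for $i,j\in[0..n-2\tau]$, if $i\in\mathsf{Sync}$ and the strings $T[i..i+2\tau)$ and $T[j..j+2\tau)$ are identical, then $j\in\mathsf{Sync}$; (Density) for $i\in[0..n-3\tau+1]$, $[i..i+\tau)\cap\mathsf{Sync}=\emptyset$ if and only if $\mathrm{per}(T[i..i+3\tau-1))\le\frac13\tau$.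 Here $\mathsf E$ models an algorithm mapping an input string $T$ to an encoding of some $\tau$-synchronizing set of $T$, and $\mathsf D$ is the accompanying decoding function that recovers the set from the encoding alone.
   Formalization: The claim fails for τ=2 (the empty encoding works) and for n=3τ (2 bits suffice); the formal version assumes τ≠2 and n≥rτ for an arbitrary fixed rational r>3, with the constant in Ω depending only on r. -}

module Defs where

open import Data.Bool.Base using (Bool)
open import Data.Fin.Base using (Fin; toℕ)
open import Data.Fin.Subset using (Subset; _∈_; _∉_)
open import Data.Integer.Base using (+_; -[1+_])
open import Data.List.Base using (List; length; lookup; take; drop)
open import Data.Nat.Base using (ℕ; suc; _+_; _*_; _∸_; _^_; _⊔_; _≤_; _<_)
open import Data.Product.Base using (_×_; ∃-syntax)
open import Data.Rational.Unnormalised.Base using (ℚᵘ; mkℚᵘ)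
open import Data.Unit.Base using (⊤)
open import Data.Vec.Base using (Vec; toList)
open import Function.Bundles using (_⇔_)
open import Relation.Binary.PropositionalEquality.Core using (_≡_)

-- T [ i ⋯ j ⟩ is T[i..j); it has length j - i whenever i ≤ j ≤ n.
_[_⋯_⟩ : ∀ {n} → Vec Bool n → ℕ → ℕ → List Bool
T [ i ⋯ j ⟩ = take (j ∸ i) (drop i (toList T))

record IsPeriod (S : List Bool) (p : ℕ) : Set where
  field
    positive : 1 ≤ p
    bounded  : p ≤ length S
    periodic : ∀ (i j : Fin (length S)) → toℕ j ≡ toℕ i + p →
               lookup S i ≡ lookup S j

-- The graph of per: IsPer S p says per(S) = p.
record IsPer (S : List Bool) (p : ℕ) : Set where
  field
    isPeriod : IsPeriod S p
    smallest : ∀ q → IsPeriod S q → p ≤ q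

-- The conditions i ≤ n - 2τ and i ≤ n - 3τ + 1 are written without
-- subtraction, so that they keep their integer meaning on ℕ.
record IsSynchronizingSet {n : ℕ} (τ : ℕ) (T : Vec Bool n) (Sync : Subset n) : Set where
  field
    range       : ∀ (i : Fin n) → i ∈ Sync → toℕ i + 2 * τ ≤ n
    consistency : ∀ (i j : Fin n) → toℕ i + 2 * τ ≤ n → toℕ j + 2 * τ ≤ n →
                  i ∈ Sync →
                  T [ toℕ i ⋯ toℕ i + 2 * τ ⟩ ≡ T [ toℕ j ⋯ toℕ j + 2 * τ ⟩ →
                  j ∈ Sync
    density     : ∀ (i : ℕ) → i + 3 * τ ≤ n + 1 →
                  (∀ (k : Fin n) → i ≤ toℕ k → toℕ k < i + τ → k ∉ Sync)
                  ⇔ (∃[ p ] (IsPer (T [ i ⋯ i + 3 * τ ∸ 1 ⟩) p × 3 * p ≤ τ))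

-- q ·lg x ≤ m is the real inequality q · log₂ (max 1 x) ≤ m, for rational q.
-- If q = a / b with a ≥ 0 and b ≥ 1, multiplying by b and exponentiating
-- turns it into (max 1 x)ᵃ ≤ 2ᵇᵐ.  If q < 0, the left side is at most 0.
_·lg_≤_ : ℚᵘ → ℕ → ℕ → Set
mkℚᵘ (+ a) b-1      ·lg x ≤ m = (1 ⊔ x) ^ a ≤ 2 ^ (suc b-1 * m)
mkℚᵘ (-[1+ _ ]) b-1 ·lg x ≤ m = ⊤

-- A word is cut into blocks of length about 4τ, each carrying a single 1 among
-- its first d ≤ τ positions.  If two such words have the 1 of block k at
-- positions x < y, the window of length 3τ - 1 starting at x + 1 is all zeros
-- in the first word, hence of period 1, while in the second word it contains
-- an isolated 1 and has no period p ≤ τ/3.  By density the two words share no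
-- synchronizing set, so E is injective on this family of d^K words.
-- When n < 4τ there is only one block, with d = n - 3τ + 1; here n ≥ rτ with
-- r > 3 ensures d ≥ 2 and τ ≤ qd, where q is the denominator of r.
module Submission where

open import Defs
open import Data.Bool.Base using (Bool; true; false)
open import Data.Fin.Base as Fin using (Fin; toℕ; fromℕ<; finToFun; funToFin)
open import Data.Fin.Properties as Fin
  using (pigeonhole; any?; toℕ<n; toℕ-fromℕ<; fromℕ<-toℕ; fromℕ<-injective; toℕ-injective;
         funToFin-finToFin)
open import Data.Fin.Subset using (Subset)
open import Data.List.Base using (List; []; _∷_; length; lookup; take; drop; applyUpTo)
open import Data.List.Properties using (length-applyUpTo; lookup-applyUpTo)
open import Data.Nat.Base using (ℕ; NonZero)
open import Data.Product.Base using (_×_; ∃-syntax; _,_; proj₁; proj₂)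
open import Data.Vec.Base as Vec using (Vec; toList)
open import Function.Base using (_∘_)
open import Function.Bundles using (Equivalence)
open import Relation.Binary.Definitions using (tri<; tri≈; tri>)
open import Relation.Binary.PropositionalEquality
open import Relation.Nullary using (¬_; yes; no; contradiction; does)
open import Relation.Nullary.Decidable using (dec-true; dec-false)

module Combinatorics where

  open import Data.Nat.Base hiding (NonZero; ℕ)
  open import Data.Nat.Properties
  open import Data.Nat.DivMod
  open import Data.Nat.Divisibility using (n∣m*n)
  open import Data.Nat.Solver using (module +-*-Solver)
  open +-*-Solver
  open import Algebra.Properties.CommutativeSemigroup +-commutativeSemigroup using (xy∙z≈xz∙y)
  import Data.Nat.Binary as ℕᵇ
  import Data.Nat.Binary.Properties as ℕᵇ

  -- Counting bit strings

  -- Bijective base-2 numeration: no digit is ever redundant, so strings of different lengths also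
  -- receive different numbers.
  bits : List Bool → ℕᵇ.ℕᵇ
  bits []           = ℕᵇ.zero
  bits (true  ∷ bs) = ℕᵇ.2[1+ bits bs ]
  bits (false ∷ bs) = ℕᵇ.1+[2 bits bs ]

  bits-injective : ∀ bs cs → bits bs ≡ bits cs → bs ≡ cs
  bits-injective []           []           _  = refl
  bits-injective []           (true  ∷ _)  ()
  bits-injective []           (false ∷ _)  ()
  bits-injective (true  ∷ _)  []           ()
  bits-injective (false ∷ _)  []           ()
  bits-injective (true  ∷ _)  (false ∷ _)  ()
  bits-injective (false ∷ _)  (true  ∷ _)  ()
  bits-injective (true  ∷ bs) (true  ∷ cs) eq =
    cong (true ∷_) (bits-injective bs cs (ℕᵇ.2[1+_]-injective eq))
  bits-injective (false ∷ bs) (false ∷ cs) eq =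
    cong (false ∷_) (bits-injective bs cs (ℕᵇ.1+[2_]-injective eq))

  -- Strings of length at most `l` occupy the numbers up to 2^(l+1) - 2. The offset `2 +` closes the
  -- induction, since `2 + 2 * suc x` is `2 * (2 + x)`.
  bits-bound : ∀ bs → 2 + ℕᵇ.toℕ (bits bs) ≤ 2 ^ suc (length bs)
  bits-bound []           = ≤-refl
  bits-bound (true  ∷ bs) = begin
    2 + 2 * suc x            ≡⟨ *-distribˡ-+ 2 1 (suc x) ⟨
    2 * (2 + x)              ≤⟨ *-monoʳ-≤ 2 (bits-bound bs) ⟩
    2 * 2 ^ suc (length bs)  ∎
    where open ≤-Reasoning
          x = ℕᵇ.toℕ (bits bs)
  bits-bound (false ∷ bs) = begin
    3 + 2 * x                ≤⟨ n≤1+n _ ⟩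
    4 + 2 * x                ≡⟨ *-distribˡ-+ 2 2 x ⟨
    2 * (2 + x)              ≤⟨ *-monoʳ-≤ 2 (bits-bound bs) ⟩
    2 * 2 ^ suc (length bs)  ∎
    where open ≤-Reasoning
          x = ℕᵇ.toℕ (bits bs)

  -- Fewer than 2 ^ suc L bit strings have length at most L.
  injective⇒long : ∀ {M} .{{_ : NonZero M}} (e : Fin M → List Bool) →
                   (∀ i j → e i ≡ e j → i ≡ j) →
                   ∃[ i ] M < 2 ^ suc (length (e i))
  injective⇒long {suc M} e inj with any? (λ i → suc M <? 2 ^ suc (length (e i)))
  ... | yes long  = long
  ... | no ¬long = contradiction (inj i j ei≡ej) (Fin.<⇒≢ i<j)
    where
    -- If no code is long, all `suc M` codes are numbered below `M`, so two of them coincide.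
    small : ∀ i → ℕᵇ.toℕ (bits (e i)) < M
    small i = s≤s⁻¹ (≤-trans (bits-bound (e i)) (≮⇒≥ (λ M< → ¬long (i , M<))))

    collision = pigeonhole (n<1+n M) (λ i → fromℕ< (small i))
    i     = proj₁ collision
    j     = proj₁ (proj₂ collision)
    i<j   = proj₁ (proj₂ (proj₂ collision))
    ei≡ej = bits-injective (e i) (e j) (ℕᵇ.toℕ-injective
              (fromℕ<-injective _ _ (small i) (small j) (proj₂ (proj₂ (proj₂ collision)))))

  -- Words, their factors and periods

  word : (ℕ → Bool) → ∀ n → Vec Bool n
  word b n = Vec.tabulate (b ∘ toℕ)

  toList-word : ∀ b n → toList (word b n) ≡ applyUpTo b n
  toList-word b zero    = refl
  toList-word b (suc n) = cong (b 0 ∷_) (toList-word (b ∘ suc) n)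

  take-drop-applyUpTo : ∀ (b : ℕ → Bool) i m {n} → i + m ≤ n →
                        take m (drop i (applyUpTo b n)) ≡ applyUpTo (λ a → b (i + a)) m
  take-drop-applyUpTo b zero    zero    _        = refl
  take-drop-applyUpTo b zero    (suc m) (s≤s le) =
    cong (b 0 ∷_) (take-drop-applyUpTo (b ∘ suc) zero m le)
  take-drop-applyUpTo b (suc i) m       (s≤s le) = take-drop-applyUpTo (b ∘ suc) i m le

  factor-word : ∀ b i m {n} → i + m ≤ n →
                word b n [ i ⋯ i + m ⟩ ≡ applyUpTo (λ a → b (i + a)) m
  factor-word b i m {n} le rewrite m+n∸m≡n i m | toList-word b n = take-drop-applyUpTo b i m le

  isPer-constant : ∀ b m → 1 ≤ m → (∀ a → a < m → b a ≡ false) → IsPer (applyUpTo b m) 1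
  isPer-constant b m 1≤m b≡false = record
    { isPeriod = record
      { positive = ≤-refl
      ; bounded  = subst (1 ≤_) (sym (length-applyUpTo b m)) 1≤m
      ; periodic = λ i j _ → trans (letter i) (sym (letter j))
      }
    ; smallest = λ q → IsPeriod.positive
    }
    where
    letter : ∀ i → lookup (applyUpTo b m) i ≡ false
    letter i = trans (lookup-applyUpTo b m i)
                     (b≡false (toℕ i) (subst (toℕ i <_) (length-applyUpTo b m) (toℕ<n i)))

  isPeriod⇒≡ : ∀ b m {p} a → IsPeriod (applyUpTo b m) p → a + p < m → b a ≡ b (a + p)
  isPeriod⇒≡ b m {p} a per a+p<m = begin
    b a                           ≡⟨ cong b (toℕ-fromℕ< a<) ⟨
    b (toℕ i)                     ≡⟨ lookup-applyUpTo b m i ⟨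
    lookup (applyUpTo b m) i      ≡⟨ IsPeriod.periodic per i j j≡i+p ⟩
    lookup (applyUpTo b m) j      ≡⟨ lookup-applyUpTo b m j ⟩
    b (toℕ j)                     ≡⟨ cong b (toℕ-fromℕ< a+p<) ⟩
    b (a + p)                     ∎
    where
    open ≡-Reasoning
    a+p< : a + p < length (applyUpTo b m)
    a+p< = subst (a + p <_) (sym (length-applyUpTo b m)) a+p<m
    a< : a < length (applyUpTo b m)
    a< = ≤-<-trans (m≤m+n a p) a+p<
    i = fromℕ< a<
    j = fromℕ< a+p<
    j≡i+p : toℕ j ≡ toℕ i + p
    j≡i+p = trans (toℕ-fromℕ< a+p<) (cong (_+ p) (sym (toℕ-fromℕ< a<)))

  -- Density turns the all-zero window of the first word into a gap of Sync,
  -- and the gap into a short period of the second word.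
  zeros⇒period : ∀ {n τ Sync} b b' → 3 ≤ τ →
                 IsSynchronizingSet τ (word b n) Sync → IsSynchronizingSet τ (word b' n) Sync →
                 ∀ i → i + 3 * τ ≤ n + 1 → (∀ a → a < 3 * τ ∸ 1 → b (i + a) ≡ false) →
                 ∃[ p ] (IsPeriod (applyUpTo (λ a → b' (i + a)) (3 * τ ∸ 1)) p × 3 * p ≤ τ)
  -- Period 1 counts as short in the density condition because `3 * 1 ≤ τ`.
  zeros⇒period {n} {τ} b b' 3≤τ sync sync' i i≤ zeros = periodic (to′ (from (1 , per1 , 3≤τ)))
    where
    open Equivalence (IsSynchronizingSet.density sync i i≤) using (from)
    open Equivalence (IsSynchronizingSet.density sync' i i≤) using () renaming (to to to′)
    m = 3 * τ ∸ 1
    3≤3τ : 3 ≤ 3 * τ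
    3≤3τ = ≤-trans 3≤τ (m≤m+n τ _)
    i+3τ∸1 : i + 3 * τ ∸ 1 ≡ i + m
    i+3τ∸1 = +-∸-assoc i (≤-trans (s≤s z≤n) 3≤3τ)
    window : ∀ b → word b n [ i ⋯ i + 3 * τ ∸ 1 ⟩ ≡ applyUpTo (λ a → b (i + a)) m
    window b = trans (cong (word b n [ i ⋯_⟩) i+3τ∸1)
                     (factor-word b i m (subst₂ _≤_ i+3τ∸1 (m+n∸n≡m n 1) (∸-monoˡ-≤ 1 i≤)))
    per1 : IsPer (word b n [ i ⋯ i + 3 * τ ∸ 1 ⟩) 1
    per1 = subst (λ S → IsPer S 1) (sym (window b))
                 (isPer-constant _ m (∸-monoˡ-≤ 1 (≤-trans (s≤s (s≤s z≤n)) 3≤3τ)) zeros)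
    periodic : ∃[ p ] (IsPer (word b' n [ i ⋯ i + 3 * τ ∸ 1 ⟩) p × 3 * p ≤ τ) →
               ∃[ p ] (IsPeriod (applyUpTo (λ a → b' (i + a)) m) p × 3 * p ≤ τ)
    periodic (p , per , 3p≤τ) =
      p , subst (λ S → IsPeriod S p) (window b') (IsPer.isPeriod per) , 3p≤τ

  -- Words with one mark per block

  -- Block k of length s carries a single 1, at offset f k.
  marks : (s : ℕ) .{{_ : NonZero s}} → (ℕ → ℕ) → ℕ → Bool
  marks s f j = does (j % s ≟ f (j / s))

  marks-block : ∀ s .{{_ : NonZero s}} f t k → t < s → marks s f (t + k * s) ≡ does (t ≟ f k)
  marks-block s f t k t<s = cong₂ (λ u v → does (u ≟ f v)) offset block
    where
    open ≡-Reasoning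
    offset : (t + k * s) % s ≡ t
    offset = trans ([m+kn]%n≡m%n t k s) (m<n⇒m%n≡m t<s)
    block : (t + k * s) / s ≡ k
    block = begin
      (t + k * s) / s    ≡⟨ +-distrib-/-∣ʳ t (n∣m*n k) ⟩
      t / s + k * s / s  ≡⟨ cong₂ _+_ (m<n⇒m/n≡0 t<s) (m*n/n≡m k s) ⟩
      k                  ∎

  -- `d + 3 * τ ≤ s` keeps a window that starts just after a mark inside its block. `n + 1` lets the
  -- last block overhang the word by one position, matching the range of the density condition.
  module _ {n τ s d K : ℕ} .{{_ : NonZero s}} (3≤τ : 3 ≤ τ) (d≤τ : d ≤ τ)
           (d+3τ≤s : d + 3 * τ ≤ s) (Ks≤n+1 : K * s ≤ n + 1) where

    -- The window that is blank in the first word still contains the mark of the second. A short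
    -- period `p` would copy that mark `p` places to the right, where the block is blank.
    marks-separated : ∀ {Sync} f f' k → k < K → f' k < d →
                      IsSynchronizingSet τ (word (marks s f) n) Sync →
                      IsSynchronizingSet τ (word (marks s f') n) Sync →
                      ¬ f k < f' k
    marks-separated f f' k k<K f'k<d sync sync' fk<f'k
      with zeros⇒period (marks s f) (marks s f') 3≤τ sync sync' i i≤ zeros
      where
      i = suc (f k) + k * s

      i≤ : i + 3 * τ ≤ n + 1
      i≤ = begin
        suc (f k) + k * s + 3 * τ    ≡⟨ xy∙z≈xz∙y (suc (f k)) (k * s) (3 * τ) ⟩
        suc (f k) + 3 * τ + k * s    ≤⟨ +-monoˡ-≤ (k * s) (+-monoˡ-≤ (3 * τ) (<-trans fk<f'k f'k<d)) ⟩
        d + 3 * τ + k * s            ≤⟨ +-monoˡ-≤ (k * s) d+3τ≤s ⟩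
        suc k * s                    ≤⟨ *-monoˡ-≤ s k<K ⟩
        K * s                        ≤⟨ Ks≤n+1 ⟩
        n + 1                        ∎
        where open ≤-Reasoning

      zeros : ∀ a → a < 3 * τ ∸ 1 → marks s f (i + a) ≡ false
      zeros a a<m = begin
        marks s f (i + a)                    ≡⟨ cong (marks s f) (xy∙z≈xz∙y (suc (f k)) (k * s) a) ⟩
        marks s f (suc (f k) + a + k * s)    ≡⟨ marks-block s f (suc (f k) + a) k t<s ⟩
        does (suc (f k) + a ≟ f k)           ≡⟨ dec-false (_ ≟ f k) (≢-sym (<⇒≢ (m≤m+n (suc (f k)) a))) ⟩
        false                                ∎
        where
        open ≡-Reasoning
        t<s : suc (f k) + a < s
        t<s = <-≤-trans (+-mono-<-≤ (<-≤-trans (s≤s fk<f'k) f'k<d)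
                                    (≤-trans (<⇒≤ a<m) (m∸n≤m (3 * τ) 1))) d+3τ≤s
    ... | p , per , 3p≤τ =
      contradiction (trans (sym one) (trans (isPeriod⇒≡ _ _ o per o+p<m) none)) λ ()
      where
      -- The place of the second word's mark, counted from the start of the window.
      o = f' k ∸ suc (f k)
      i = suc (f k) + k * s

      fk+o : suc (f k) + o ≡ f' k
      fk+o = m+[n∸m]≡n fk<f'k

      p≤τ : p ≤ τ
      p≤τ = ≤-trans (m≤m+n p _) 3p≤τ

      -- Both compared letters must lie in the window: `o < τ` and `p ≤ τ` give a position below 2τ
      -- ≤ 3τ - 1.
      o+p<m : o + p < 3 * τ ∸ 1
      o+p<m = begin-strict
        o + p        <⟨ +-mono-<-≤ (≤-<-trans (m∸n≤m (f' k) (suc (f k))) (<-≤-trans f'k<d d≤τ)) p≤τ ⟩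
        τ + τ        ≡⟨ cong (λ u → τ + u) (+-identityʳ τ) ⟨
        2 * τ        ≤⟨ ∸-monoˡ-≤ 1 (+-monoˡ-≤ (2 * τ) (≤-trans (s≤s z≤n) 3≤τ)) ⟩
        3 * τ ∸ 1    ∎
        where open ≤-Reasoning

      one : marks s f' (i + o) ≡ true
      one = begin
        marks s f' (i + o)                  ≡⟨ cong (marks s f') (xy∙z≈xz∙y (suc (f k)) (k * s) o) ⟩
        marks s f' (suc (f k) + o + k * s)  ≡⟨ cong (λ t → marks s f' (t + k * s)) fk+o ⟩
        marks s f' (f' k + k * s)           ≡⟨ marks-block s f' (f' k) k (<-≤-trans f'k<d (≤-trans (m≤m+n d _) d+3τ≤s)) ⟩
        does (f' k ≟ f' k)                  ≡⟨ dec-true (f' k ≟ f' k) refl ⟩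
        true                                ∎
        where open ≡-Reasoning

      -- As `p ≥ 1`, the mark itself is left behind; as `f' k + p < s`, the mark of the next block
      -- is not reached.
      none : marks s f' (i + (o + p)) ≡ false
      none = begin
        marks s f' (i + (o + p))                  ≡⟨ cong (marks s f') (xy∙z≈xz∙y (suc (f k)) (k * s) (o + p)) ⟩
        marks s f' (suc (f k) + (o + p) + k * s)  ≡⟨ cong (λ t → marks s f' (t + k * s)) (+-assoc (suc (f k)) o p) ⟨
        marks s f' (suc (f k) + o + p + k * s)    ≡⟨ cong (λ t → marks s f' (t + p + k * s)) fk+o ⟩
        marks s f' (f' k + p + k * s)             ≡⟨ marks-block s f' (f' k + p) k t<s ⟩
        does (f' k + p ≟ f' k)                    ≡⟨ dec-false (_ ≟ f' k) (≢-sym (<⇒≢ (m<m+n (f' k) (IsPeriod.positive per)))) ⟩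
        false                                     ∎
        where
        open ≡-Reasoning
        t<s : f' k + p < s
        t<s = <-≤-trans (+-mono-<-≤ f'k<d (≤-trans p≤τ (m≤m+n τ _))) d+3τ≤s

    -- Indexing the words by digits in base d

    extend : (Fin K → Fin d) → ℕ → ℕ
    extend g k with k <? K
    ... | yes k<K = toℕ (g (fromℕ< k<K))
    -- The rest of the word beyond block `K - 1` is marked in the same way in every word and is
    -- never compared.
    ... | no  _   = 0

    extend-toℕ : ∀ g k → extend g (toℕ k) ≡ toℕ (g k)
    extend-toℕ g k with toℕ k <? K
    ... | yes k<K = cong (toℕ ∘ g) (fromℕ<-toℕ k k<K)
    ... | no  k≮K = contradiction (toℕ<n k) k≮K

    -- A number below `d ^ K` supplies `K` digits, and digit `k` places the mark of block `k`. Equal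
    -- codes decode to one set that is synchronizing for both words, so by `marks-separated` no
    -- digit can differ.
    long-encoding : .{{_ : NonZero d}} (E : Vec Bool n → List Bool) (D : List Bool → Subset n) →
                    (∀ T → IsSynchronizingSet τ T (D (E T))) →
                    ∃[ T ] d ^ K < 2 ^ suc (length (E T))
    long-encoding E D sync = T (proj₁ long) , proj₂ long
      where
      digits : Fin (d ^ K) → ℕ → ℕ
      digits x = extend (finToFun x)

      T : Fin (d ^ K) → Vec Bool n
      T x = word (marks s (digits x)) n

      digit< : ∀ x k → digits x (toℕ k) < d
      digit< x k = subst (_< d) (sym (extend-toℕ (finToFun x) k)) (toℕ<n (finToFun x k))

      funToFin-cong : ∀ {m n} {g h : Fin m → Fin n} → (∀ i → g i ≡ h i) → funToFin g ≡ funToFin h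
      funToFin-cong {zero}  eq = refl
      funToFin-cong {suc m} eq = cong₂ Fin.combine (eq Fin.zero) (funToFin-cong (eq ∘ Fin.suc))

      injective : ∀ x y → E (T x) ≡ E (T y) → x ≡ y
      injective x y eq = begin
        x                              ≡⟨ funToFin-finToFin {K} {d} x ⟨
        funToFin (finToFun {d} {K} x)  ≡⟨ funToFin-cong same ⟩
        funToFin (finToFun {d} {K} y)  ≡⟨ funToFin-finToFin {K} {d} y ⟩
        y                              ∎
        where
        open ≡-Reasoning
        syncʸ : IsSynchronizingSet τ (T y) (D (E (T x)))
        syncʸ = subst (λ e → IsSynchronizingSet τ (T y) (D e)) (sym eq) (sync (T y))
        same : ∀ k → finToFun {d} {K} x k ≡ finToFun y k
        same k with <-cmp (digits x (toℕ k)) (digits y (toℕ k))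
        ... | tri< x<y _ _ =
          contradiction x<y (marks-separated (digits x) (digits y) (toℕ k) (toℕ<n k)
            (digit< y k) (sync (T x)) syncʸ)
        ... | tri> _ _ y<x =
          contradiction y<x (marks-separated (digits y) (digits x) (toℕ k) (toℕ<n k)
            (digit< x k) syncʸ (sync (T x)))
        ... | tri≈ _ x≡y _ =
          toℕ-injective (trans (sym (extend-toℕ (finToFun x) k)) (trans x≡y (extend-toℕ (finToFun y) k)))

      instance d^K≢0 : NonZero (d ^ K)
      d^K≢0 = m^n≢0 d K

      long = injective⇒long (E ∘ T) injective

  -- From counting to the exponential bound

  -- Absorbs the additive 1 of the counting bound: `2 ≤ x` excludes `L = 0`, and then L + 1 ≤ 2L.
  <2^1+⇒≤2^2* : ∀ {x} L → 2 ≤ x → x < 2 ^ suc L → x ≤ 2 ^ (2 * L)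
  <2^1+⇒≤2^2* zero    2≤x x<2 = contradiction x<2 (≤⇒≯ 2≤x)
  <2^1+⇒≤2^2* (suc L) 2≤x x<  = ≤-trans (<⇒≤ x<) (^-monoʳ-≤ 2 (s≤s (≤-trans (m≤m+n (suc L) 0) (m≤n+m _ L))))

  -- With `K ≥ 1` blocks the remainder is at most another `K * (4 * τ)`, so n ≤ 8τK; together with
  -- τ^K ≤ 2^(2L) this gives the exponent 16τL. The term `4 * q` is slack that gives both cases the
  -- same constant.
  bound-many-blocks : ∀ {n τ} q L .{{_ : NonZero τ}} .{{_ : NonZero (4 * τ)}} → 2 ≤ τ → 4 * τ ≤ n →
                      τ ^ (n / (4 * τ)) < 2 ^ suc L →
                      τ ^ n ≤ 2 ^ ((16 + 4 * q) * τ * L)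
  bound-many-blocks {n} {τ} q L 2≤τ 4τ≤n τ^K< = begin
    τ ^ n                         ≤⟨ ^-monoʳ-≤ τ n≤ ⟩
    τ ^ (K * (8 * τ))             ≡⟨ ^-*-assoc τ K (8 * τ) ⟨
    (τ ^ K) ^ (8 * τ)             ≤⟨ ^-monoˡ-≤ (8 * τ) (<2^1+⇒≤2^2* L 2≤τ^K τ^K<) ⟩
    (2 ^ (2 * L)) ^ (8 * τ)       ≡⟨ ^-*-assoc 2 (2 * L) (8 * τ) ⟩
    2 ^ (2 * L * (8 * τ))         ≡⟨ cong (2 ^_) (solve 2 (λ l t → con 2 :* l :* (con 8 :* t) := con 16 :* t :* l) refl L τ) ⟩
    2 ^ (16 * τ * L)              ≤⟨ ^-monoʳ-≤ 2 (*-monoˡ-≤ L (*-monoˡ-≤ τ (m≤m+n 16 (4 * q)))) ⟩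
    2 ^ ((16 + 4 * q) * τ * L)    ∎
    where
    open ≤-Reasoning
    K = n / (4 * τ)
    K≥1 : 1 ≤ K
    K≥1 = m≥n⇒m/n>0 4τ≤n
    instance K≢0 : NonZero K
    K≢0 = >-nonZero K≥1
    2≤τ^K : 2 ≤ τ ^ K
    2≤τ^K = ≤-trans 2≤τ (≤-trans (≤-reflexive (sym (*-identityʳ τ))) (^-monoʳ-≤ τ K≥1))
    n≤ : n ≤ K * (8 * τ)
    n≤ = begin
      n                              ≡⟨ m≡m%n+[m/n]*n n (4 * τ) ⟩
      n % (4 * τ) + K * (4 * τ)      ≤⟨ +-monoˡ-≤ (K * (4 * τ)) (≤-trans (m%n≤n n (4 * τ)) (m≤n*m (4 * τ) K)) ⟩
      K * (4 * τ) + K * (4 * τ)      ≡⟨ solve 2 (λ k t → k :* (con 4 :* t) :+ k :* (con 4 :* t) := k :* (con 8 :* t)) refl K τ ⟩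
      K * (8 * τ)                    ∎

  n≤2^n : ∀ n → n ≤ 2 ^ n
  n≤2^n zero    = z≤n
  n≤2^n (suc n) = +-mono-≤ (m^n>0 2 n) (subst (n ≤_) (sym (+-identityʳ (2 ^ n))) (n≤2^n n))

  -- Choosing `d` instead of `τ` positions costs a factor `q`, which is at most 2^(qL) once `L ≥ 1`;
  -- `L = 0` is impossible since `d ≥ 2`. Raising to the power 4τ ≥ n gives the exponent (8 + 4q)τL.
  bound-one-block : ∀ {n τ d} q L .{{_ : NonZero τ}} → n ≤ 4 * τ → 2 ≤ d → τ ≤ q * d →
                    d < 2 ^ suc L → τ ^ n ≤ 2 ^ ((16 + 4 * q) * τ * L)
  bound-one-block q zero n≤4τ 2≤d τ≤qd d< = contradiction d< (≤⇒≯ 2≤d)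
  bound-one-block {n} {τ} {d} q L@(suc _) n≤4τ 2≤d τ≤qd d< = begin
    τ ^ n                           ≤⟨ ^-monoʳ-≤ τ n≤4τ ⟩
    τ ^ (4 * τ)                     ≤⟨ ^-monoˡ-≤ (4 * τ) τ≤ ⟩
    (2 ^ (q * L + 2 * L)) ^ (4 * τ) ≡⟨ ^-*-assoc 2 (q * L + 2 * L) (4 * τ) ⟩
    2 ^ ((q * L + 2 * L) * (4 * τ)) ≡⟨ cong (2 ^_) (solve 3 (λ x l t → (x :* l :+ con 2 :* l) :* (con 4 :* t) := (con 8 :+ con 4 :* x) :* t :* l) refl q L τ) ⟩
    2 ^ ((8 + 4 * q) * τ * L)       ≤⟨ ^-monoʳ-≤ 2 (*-monoˡ-≤ L (*-monoˡ-≤ τ (m≤n+m (8 + 4 * q) 8))) ⟩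
    2 ^ ((16 + 4 * q) * τ * L)      ∎
    where
    open ≤-Reasoning
    τ≤ : τ ≤ 2 ^ (q * L + 2 * L)
    τ≤ = begin
      τ                          ≤⟨ τ≤qd ⟩
      q * d                      ≤⟨ *-mono-≤ (≤-trans (n≤2^n q) (^-monoʳ-≤ 2 (m≤m*n q L))) (<2^1+⇒≤2^2* L 2≤d d<) ⟩
      2 ^ (q * L) * 2 ^ (2 * L)  ≡⟨ ^-distribˡ-+-* 2 (q * L) (2 * L) ⟨
      2 ^ (q * L + 2 * L)        ∎

  lower-bound : ∀ {n τ} q → 3 ≤ τ → (3 * q + 1) * τ ≤ n * q →
                (E : Vec Bool n → List Bool) (D : List Bool → Subset n) →
                (∀ T → IsSynchronizingSet τ T (D (E T))) →
                ∃[ T ] τ ^ n ≤ 2 ^ ((16 + 4 * q) * τ * length (E T))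
  lower-bound {n} {τ@(suc _)} q 3≤τ rτ≤n E D sync with 4 * τ ≤? n
  ... | yes 4τ≤n = T , bound-many-blocks q (length (E T)) (≤-trans (s≤s (s≤s z≤n)) 3≤τ) 4τ≤n T-long
    where
    encoding = long-encoding {s = 4 * τ} {d = τ} {K = n / (4 * τ)} 3≤τ ≤-refl ≤-refl
                 (≤-trans (m/n*n≤m n (4 * τ)) (m≤m+n n 1)) E D sync
    T = proj₁ encoding
    T-long = proj₂ encoding
  ... | no  4τ≰n = T , bound-one-block q (length (E T)) (<⇒≤ n<4τ) 2≤d τ≤qd
                       (subst (_< 2 ^ suc (length (E T))) (*-identityʳ d) T-long)
    where
    open ≤-Reasoning
    n<4τ = ≰⇒> 4τ≰n
    e = n ∸ 3 * τ
    d = suc e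
    3τ<n : 3 * τ < n
    3τ<n = *-cancelʳ-< q _ _ (begin-strict
      3 * τ * q              ≡⟨ solve 2 (λ t x → con 3 :* t :* x := con 3 :* x :* t) refl τ q ⟩
      3 * q * τ              <⟨ *-monoˡ-< τ (m<m+n (3 * q) (s≤s z≤n)) ⟩
      (3 * q + 1) * τ        ≤⟨ rτ≤n ⟩
      n * q                  ∎)
    e+3τ≡n : e + 3 * τ ≡ n
    e+3τ≡n = m∸n+n≡m (<⇒≤ 3τ<n)
    2≤d : 2 ≤ d
    2≤d = s≤s (m<n⇒0<n∸m 3τ<n)
    d≤τ : d ≤ τ
    d≤τ = +-cancelʳ-≤ (3 * τ) _ _ (subst (λ m → suc m ≤ 4 * τ) (sym e+3τ≡n) n<4τ)
    -- The excess `e` of `n` over 3τ is at least τ/q.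
    τ≤qd : τ ≤ q * d
    τ≤qd = ≤-trans (+-cancelʳ-≤ (3 * q * τ) _ _ (begin
      τ + 3 * q * τ          ≡⟨ solve 2 (λ t x → t :+ con 3 :* x :* t := (con 3 :* x :+ con 1) :* t) refl τ q ⟩
      (3 * q + 1) * τ        ≤⟨ rτ≤n ⟩
      n * q                  ≡⟨ cong (_* q) e+3τ≡n ⟨
      (e + 3 * τ) * q        ≡⟨ solve 3 (λ y t x → (y :+ con 3 :* t) :* x := x :* y :+ con 3 :* x :* t) refl e τ q ⟩
      q * e + 3 * q * τ      ∎)) (*-monoʳ-≤ q (n≤1+n e))
    -- The single block overhangs by one, so that `d + 3 * τ` equals its length n + 1.
    encoding = long-encoding {s = suc n} {d = d} {K = 1} 3≤τ d≤τ
                 (≤-reflexive (cong suc e+3τ≡n)) (≤-reflexive (trans (+-identityʳ (suc n)) (+-comm 1 n))) E D sync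
    T = proj₁ encoding
    T-long = proj₂ encoding

-- Passage to rational constants

open import Data.Integer.Base using (+_; -[1+_]; +<+)
import Data.Integer.Base as ℤ
open import Data.Integer.Properties using (drop‿+≤+; drop‿+<+; pos-*)
import Data.Nat.Base as ℕ
import Data.Nat.Properties as ℕ
open import Data.Rational.Unnormalised.Base using (ℚᵘ; 0ℚᵘ; mkℚᵘ; _/_; _*_; _≤_; _<_; *<*; *≤*)

lemma6p1 : (r : ℚᵘ) → + 3 / 1 < r →
    ∃[ c ] (0ℚᵘ < c ×
    ((n τ : ℕ) → .{{_ : NonZero n}} → .{{_ : NonZero τ}} →
    τ ≢ 2 → r * (+ τ / 1) ≤ + n / 1 →
    (E : Vec Bool n → List Bool) (D : List Bool → Subset n) →
    (∀ T → IsSynchronizingSet τ T (D (E T))) →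
    ∃[ T ] ((c * (+ n / τ)) ·lg τ ≤ length (E T))))
lemma6p1 (mkℚᵘ -[1+ _ ] _) (*<* ())
lemma6p1 (mkℚᵘ (+ a) q-1) (*<* 3q<a) =
  -- c = 1/(16 + 4q); `mkℚᵘ` stores the denominator minus one.
  mkℚᵘ (+ 1) (15 ℕ.+ 4 ℕ.* q) , *<* (+<+ (ℕ.s≤s ℕ.z≤n)) , bound
  where
  q = ℕ.suc q-1

  -- By integrality, r > 3 already means r ≥ 3 + 1/q.
  3q+1≤a : 3 ℕ.* q ℕ.+ 1 ℕ.≤ a
  3q+1≤a = subst₂ ℕ._≤_ (ℕ.+-comm 1 (3 ℕ.* q)) (ℕ.*-identityʳ a)
             (drop‿+<+ (subst₂ ℤ._<_ refl (sym (pos-* a 1)) 3q<a))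

  bound : (n τ : ℕ) → .{{_ : NonZero n}} → .{{_ : NonZero τ}} →
          τ ≢ 2 → mkℚᵘ (+ a) q-1 * (+ τ / 1) ≤ + n / 1 →
          (E : Vec Bool n → List Bool) (D : List Bool → Subset n) →
          (∀ T → IsSynchronizingSet τ T (D (E T))) →
          ∃[ T ] ((mkℚᵘ (+ 1) (15 ℕ.+ 4 ℕ.* q) * (+ n / τ)) ·lg τ ≤ length (E T))
  -- lg 1 = 0, so any word will do.
  bound n@(ℕ.suc _) 1 _ _ E D sync = T ,
    ℕ.≤-trans (ℕ.≤-reflexive (ℕ.^-zeroˡ (n ℕ.+ 0)))
              (ℕ.m^n>0 2 ((16 ℕ.+ 4 ℕ.* q) ℕ.* 1 ℕ.* length (E T)))
    where T = Vec.replicate n false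
  -- At τ = 2 no period satisfies 3p ≤ τ, so all of [0..n-2τ] is synchronizing for every word and a
  -- constant encoder defeats the bound.
  bound _ 2 τ≢2 _ _ _ _ = contradiction refl τ≢2
  bound n@(ℕ.suc _) τ@(ℕ.suc (ℕ.suc (ℕ.suc _))) _ (*≤* aτ≤nq) E D sync = T ,
    -- The rational c · n/τ computes to numerator `n + 0` and denominator (16 + 4q)τ.
    subst (λ m → τ ℕ.^ m ℕ.≤ 2 ℕ.^ ((16 ℕ.+ 4 ℕ.* q) ℕ.* τ ℕ.* length (E T))) (sym (ℕ.+-identityʳ n)) T-long
    where
    aτ≤nq′ : a ℕ.* τ ℕ.≤ n ℕ.* q
    aτ≤nq′ = subst₂ ℕ._≤_ (ℕ.*-identityʳ (a ℕ.* τ)) (cong (n ℕ.*_) (ℕ.*-identityʳ q))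
               (drop‿+≤+ (subst₂ ℤ._≤_
                 (trans (cong (ℤ._* + 1) (sym (pos-* a τ))) (sym (pos-* (a ℕ.* τ) 1)))
                 (sym (pos-* n (q ℕ.* 1))) aτ≤nq))
    encoding = Combinatorics.lower-bound q (ℕ.s≤s (ℕ.s≤s (ℕ.s≤s ℕ.z≤n)))
                 (ℕ.≤-trans (ℕ.*-monoˡ-≤ τ 3q+1≤a) aτ≤nq′) E D sync
    T = proj₁ encoding
    T-long = proj₂ encoding
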